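{- Let $(A,\mathit{Con},\mid\!\sim)$ be an abstract nonmonotonic system. Then there is a normal default structure $(B,\mathit{Con}^*,\Delta)$ (with trivial entailment) such that: (1) $B\supseteq A$; (2) for every $X\subseteq B$, $X\in\mathit{Con}$ if and only if $X\subseteq A$ and $X\in\mathit{Con}^*$; (3) for all $X,Y\in\mathit{Con}$, $X\mid\!\sim Y$ if and only if $X\mid\!\sim_B Y$, where $\mid\!\sim_B$ is the skeptical nonmonotonic consequence relation of $(B,\mathit{Con}^*,\Delta)$.
   Context: An abstract nonmonotonic system is a triple $(A,\mathit{Con},\mid\!\sim)$ where $\mathit{Con}$ is a collection of finite subsets of $A$ and $\mid\!\sim\ \subseteq\mathit{Con}\times\mathit{Con}$, satisfying: (1) $X\subseteq Y\in\mathit{Con}\Rightarrow X\in\mathit{Con}$; (2) $a\in A\Rightarrow\{a\}\in\mathit{Con}$; (3) $X\mid\!\sim T\Rightarrow X\cup T\in\mathit{Con}$; (4) $Y\subseteq X\Rightarrow X\mid\!\sim Y$; (5) $X\mid\!\sim T$ and $T\cup X\mid\!\sim Y$ imply $X\mid\!\sim Y$; (6) $X\mid\!\sim Y$ and $X\mid\!\sim Z$ imply $X\mid\!\sim Y\cup Z$. A normal default structure (with trivial entailment) is a triple $(B,\mathit{Con}^*,\Delta)$ where $B$ is a set of tokens; $\mathit{Con}^*$ is a set of finite subsets of $B$ with $\emptyset\in\mathit{Con}^*$, closed under subsets, and containing $\{b\}$ for each $b\in B$; an arbitrary subset of $B$ is consistent if all its finite subsets are in $\mathit{Con}^*$; $\Delta$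 is a set of normal defaults $\frac{X:a}{a}$ with $X\in\mathit{Con}^*$ and $a\in B$. For consistent $x\subseteq B$ and $S\subseteq B$: $\phi(x,S,0)=x$, $\phi(x,S,i+1)=\phi(x,S,i)\cup\{a\mid\frac{X:a}{a}\in\Delta,\ X\subseteq\phi(x,S,i),\ \{a\}\cup S \text{ consistent}\}$, $\Phi(x,S)=\bigcup_i\phi(x,S,i)$; $y$ is an extension of $x$ if $\Phi(x,y)=y$. The skeptical relation: for $X\in\mathit{Con}^*$ and finite $Y\subseteq B$, $X\mid\!\sim_B Y$ iff every element of $Y$ belongs to every extension of $X$.
   Formalization: The collection Con is assumed non-empty; this excludes only the case where A and Con are both empty, in which the statement fails because the empty set lies in Con* but not in Con. -}

module Defs where

open import Level using (Level; suc)
open import Data.Nat.Base using (ℕ; zero) renaming (suc to 1+)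
open import Data.List.Base using (List; []; [_]; _++_)
open import Data.List.Membership.Propositional using (_∈_)
open import Data.List.Relation.Binary.Subset.Propositional using () renaming (_⊆_ to _⊆ˡ_)
open import Data.Product using (∃; _×_)
open import Relation.Unary using (Pred; _∪_; _⊆_; _≐_; ｛_｝)

-- A finite subset of A is represented by a list enumerating it; two lists
-- denote the same finite subset when each is contained in the other.
-- Arbitrary subsets are predicates, compared by extensional equality _≐_.

⟪_⟫ : ∀ {ℓ} {A : Set ℓ} → List A → Pred A ℓ
⟪ F ⟫ a = a ∈ F

-- The subset X is (denoted by) a member of the collection C of finite subsets.
infix 4 _∈ᶠ_
_∈ᶠ_ : ∀ {ℓ} {A : Set ℓ} → Pred A ℓ → Pred (List A) ℓ → Set ℓ
X ∈ᶠ C = ∃ λ F → C F × X ≐ ⟪ F ⟫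

record AbstractNonmonotonicSystem (ℓ : Level) : Set (suc ℓ) where
  infix 4 _|∼_
  field
    A    : Set ℓ
    Con  : Pred (List A) ℓ
    _|∼_ : List A → List A → Set ℓ

    -- _|∼_ relates members of Con, and is well defined on finite subsets.  For
    -- Con and for the right argument of _|∼_, independence of the enumeration
    -- follows from the axioms below.
    |∼⇒Conˡ  : ∀ {X T} → X |∼ T → Con X
    |∼⇒Conʳ  : ∀ {X T} → X |∼ T → Con T
    |∼-respˡ : ∀ {X X′ T} → X ⊆ˡ X′ → X′ ⊆ˡ X → X |∼ T → X′ |∼ T

    Con-⊆         : ∀ {X Y} → X ⊆ˡ Y → Con Y → Con X
    Con-singleton : ∀ a → Con [ a ]
    |∼⇒Con-∪      : ∀ {X T} → X |∼ T → Con (X ++ T)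
    |∼-reflexive  : ∀ {X Y} → Con X → Y ⊆ˡ X → X |∼ Y
    |∼-cut        : ∀ {X T Y} → X |∼ T → T ++ X |∼ Y → X |∼ Y
    |∼-∪          : ∀ {X Y Z} → X |∼ Y → X |∼ Z → X |∼ Y ++ Z

record NormalDefaultStructure (ℓ : Level) : Set (suc ℓ) where
  field
    B    : Set ℓ
    Con* : Pred (List B) ℓ
    -- Δ X a says that the normal default X : a / a is present.
    Δ    : List B → B → Set ℓ

    Con*-∅         : Con* []
    Con*-⊆         : ∀ {X Y} → X ⊆ˡ Y → Con* Y → Con* X
    Con*-singleton : ∀ b → Con* [ b ]
    Δ⇒Con*         : ∀ {X a} → Δ X a → Con* X
    Δ-resp         : ∀ {X X′ a} → X ⊆ˡ X′ → X′ ⊆ˡ X → Δ X a → Δ X′ a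

  Consistent : Pred B ℓ → Set ℓ
  Consistent S = ∀ F → ⟪ F ⟫ ⊆ S → Con* F

  φ : Pred B ℓ → Pred B ℓ → ℕ → Pred B ℓ
  φ x S zero   = x
  φ x S (1+ i) = φ x S i ∪
    λ a → ∃ λ X → Δ X a × ⟪ X ⟫ ⊆ φ x S i × Consistent (｛ a ｝ ∪ S)

  Φ : Pred B ℓ → Pred B ℓ → Pred B ℓ
  Φ x S b = ∃ λ i → φ x S i b

  IsExtension : Pred B ℓ → Pred B ℓ → Set ℓ
  IsExtension x y = Φ x y ≐ y

  infix 4 _|∼ᴮ_
  _|∼ᴮ_ : List B → List B → Set (suc ℓ)
  X |∼ᴮ Y = Con* X × (∀ (y : Pred B ℓ) → IsExtension ⟪ X ⟫ y → ⟪ Y ⟫ ⊆ y)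

{-# OPTIONS --safe #-}

-- Write cl Y = {a | Y |∼ {a}}.  Cut gives cl X ⊆ cl Y whenever Y ⊆ X ⊆ cl Y, and an
-- extension of such a Y is automatically an extension of X.  So the extensions of X
-- should be exactly the sets
--   E Y = cl Y ∪ {admit X | Y ⊆ X ⊆ cl Y} ∪ {root Y}      for Y ⊆ X ⊆ cl Y,
-- where admit X and root X are new tokens; the finite subsets of the sets E Y are taken
-- as the consistent ones.  The defaults are X : admit X, X : root X and, for X |∼ {a},
-- admit X : a.  The token root X belongs to E X only, which makes E X maximal, hence an
-- extension of X whose trace on A is cl X.  The token admit X is compatible with every
-- extension y of X (whatever root was chosen in y), so admit X ∈ y and then cl X ⊆ y;
-- this argument does not need to decide which root belongs to y.
module Submission where

open import Level using (Level)
open import Data.List.Base using (List; []; _∷_; [_]; _++_; map)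
open import Data.List.Membership.Propositional using (_∈_)
open import Data.List.Membership.Propositional.Properties using (∈-map⁺; ∈-map⁻; ∈-++⁺ˡ; ∈-++⁺ʳ; ∈-++⁻)
open import Data.List.Relation.Binary.Subset.Propositional using () renaming (_⊆_ to _⊆ˡ_)
open import Data.List.Relation.Unary.Any using (here; there)
open import Data.Nat.Base using (zero; _⊔_; _≤′_; ≤′-refl; ≤′-step) renaming (suc to 1+)
open import Data.Nat.Properties using (≤⇒≤′; m≤m⊔n; m≤n⊔m)
open import Data.Product using (Σ; ∃; _×_; _,_; proj₁; proj₂)
open import Data.Sum using (_⊎_; inj₁; inj₂; [_,_]′)
open import Function.Base using (id; _∘_)
open import Function.Bundles using (_⇔_; mk⇔)
open import Function.Definitions using (Injective)
open import Relation.Binary.PropositionalEquality using (_≡_; refl)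
open import Relation.Unary using (Pred; _∪_; _⊆_; _≐_; ｛_｝)
open import Defs

-- Inclusions of finite sets

module _ {a} {A : Set a} where

  [-]-⊆ : ∀ {p} (P : Pred A p) {x} → P x → ⟪ [ x ] ⟫ ⊆ P
  [-]-⊆ P px (here refl) = px

  ∷-⊆ : ∀ {p} {P : Pred A p} {x F} → P x → ⟪ F ⟫ ⊆ P → ⟪ x ∷ F ⟫ ⊆ P
  ∷-⊆ px F⊆P (here refl) = px
  ∷-⊆ px F⊆P (there b∈F) = F⊆P b∈F

  ++-⊆ : ∀ {p} {P : Pred A p} F {G} → ⟪ F ⟫ ⊆ P → ⟪ G ⟫ ⊆ P → ⟪ F ++ G ⟫ ⊆ P
  ++-⊆ F F⊆P G⊆P b∈ = [ F⊆P , G⊆P ]′ (∈-++⁻ F b∈)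

  map-⊆ : ∀ {b p} {B : Set b} (P : Pred B p) (f : A → B) {F} → ⟪ F ⟫ ⊆ P ∘ f → ⟪ map f F ⟫ ⊆ P
  map-⊆ P f F⊆P b∈ with ∈-map⁻ f b∈
  ... | _ , x∈F , refl = F⊆P x∈F

  -- `Q` does not mention `x`, so a single element yielding `Q` settles the alternative. Finiteness
  -- of `F` makes the case distinction constructive.
  ⊆-or : ∀ {p q} {P : Pred A p} {Q : Set q} F → (∀ {x} → x ∈ F → P x ⊎ Q) → ⟪ F ⟫ ⊆ P ⊎ Q
  ⊆-or []      _  = inj₁ λ ()
  ⊆-or (x ∷ F) pq with pq (here refl) | ⊆-or F (pq ∘ there)
  ... | inj₂ q  | _        = inj₂ q
  ... | inj₁ _  | inj₂ q   = inj₂ q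
  ... | inj₁ px | inj₁ F⊆P = inj₁ (∷-⊆ px F⊆P)

  -- Occurrences of `c` are dropped as the hypothesis labels them, so equality with `c` is never
  -- tested.
  ⊆-split : ∀ {p} {P : Pred A p} {c} F → ⟪ F ⟫ ⊆ ｛ c ｝ ∪ P →
            ∃ λ G → ⟪ G ⟫ ⊆ P × F ⊆ˡ c ∷ G
  ⊆-split []      _  = [] , (λ ()) , λ ()
  ⊆-split (x ∷ F) F⊆ with F⊆ (here refl) | ⊆-split F (F⊆ ∘ there)
  ... | inj₁ refl | G , G⊆P , F⊆G = G , G⊆P , ∷-⊆ (here refl) F⊆G
  ... | inj₂ px   | G , G⊆P , F⊆G =
    x ∷ G , ∷-⊆ px G⊆P , ∷-⊆ (there (here refl)) (∷-⊆ (here refl) (there ∘ there) ∘ F⊆G)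

  ⊆-range : ∀ {b} {B : Set b} (f : A → B) G → ⟪ G ⟫ ⊆ (λ y → ∃ λ x → f x ≡ y) →
            ∃ λ F → map f F ≡ G
  ⊆-range f []      _  = [] , refl
  ⊆-range f (y ∷ G) G⊆ with G⊆ (here refl) | ⊆-range f G (G⊆ ∘ there)
  ... | x , refl | F , refl = x ∷ F , refl

-- Closure and minimality of `Φ`

module DefaultProperties {ℓ} (D : NormalDefaultStructure ℓ) where
  open NormalDefaultStructure D

  module _ {x S : Pred B ℓ} where

    φ-mono : ∀ {i j} → i ≤′ j → φ x S i ⊆ φ x S j
    φ-mono ≤′-refl       b∈ = b∈
    φ-mono (≤′-step i≤j) b∈ = inj₁ (φ-mono i≤j b∈)

    -- Stages increase, so the maximum of the finitely many stages involved contains all of `F`.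
    ⊆Φ⇒⊆φ : ∀ F → ⟪ F ⟫ ⊆ Φ x S → ∃ λ i → ⟪ F ⟫ ⊆ φ x S i
    ⊆Φ⇒⊆φ []      _  = zero , λ ()
    ⊆Φ⇒⊆φ (b ∷ F) F⊆ with F⊆ (here refl) | ⊆Φ⇒⊆φ F (F⊆ ∘ there)
    ... | i , b∈ | j , F⊆φ =
      i ⊔ j , ∷-⊆ (φ-mono (≤⇒≤′ (m≤m⊔n i j)) b∈) (φ-mono (≤⇒≤′ (m≤n⊔m i j)) ∘ F⊆φ)

    Φ-step : ∀ {X b} → Δ X b → ⟪ X ⟫ ⊆ Φ x S → Consistent (｛ b ｝ ∪ S) → Φ x S b
    Φ-step {X} δ X⊆Φ con with ⊆Φ⇒⊆φ X X⊆Φ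
    ... | i , X⊆φ = 1+ i , inj₂ (X , δ , X⊆φ , con)

    Φ-least : ∀ {P : Pred B ℓ} → x ⊆ P →
              (∀ {X b} → Δ X b → ⟪ X ⟫ ⊆ P → Consistent (｛ b ｝ ∪ S) → P b) → Φ x S ⊆ P
    Φ-least {P} x⊆P closed (i , b∈) = go i b∈
      where
      go : ∀ i → φ x S i ⊆ P
      go zero   b∈x                      = x⊆P b∈x
      go (1+ i) (inj₁ b∈)                = go i b∈
      go (1+ i) (inj₂ (X , δ , X⊆ , con)) = closed δ (λ c∈X → go i (X⊆ c∈X)) con

-- Derived rules of the abstract system

module Representation {ℓ} (N : AbstractNonmonotonicSystem ℓ) where
  open AbstractNonmonotonicSystem N

  |∼-refl : ∀ {X} → Con X → X |∼ X
  |∼-refl X-con = |∼-reflexive X-con id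

  |∼-weaken : ∀ {X Y Z} → X |∼ Y → Z ⊆ˡ Y → X |∼ Z
  |∼-weaken {X} {Y} X|∼Y Z⊆Y =
    |∼-cut X|∼Y (|∼-reflexive (Con-⊆ (++-⊆ Y (∈-++⁺ʳ X) ∈-++⁺ˡ) (|∼⇒Con-∪ X|∼Y)) (∈-++⁺ˡ ∘ Z⊆Y))

  |∼-element : ∀ {X Y a} → X |∼ Y → a ∈ Y → X |∼ [ a ]
  |∼-element {Y = Y} X|∼Y a∈Y = |∼-weaken X|∼Y ([-]-⊆ (_∈ Y) a∈Y)

  |∼-pointwise : ∀ {X} Y → Con X → ⟪ Y ⟫ ⊆ (λ a → X |∼ [ a ]) → X |∼ Y
  |∼-pointwise []      X-con _  = |∼-reflexive X-con λ ()
  |∼-pointwise (_ ∷ Y) X-con Y⊆ = |∼-∪ (Y⊆ (here refl)) (|∼-pointwise Y X-con (Y⊆ ∘ there))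

  -- Cut applies because `Y ⊆ X` makes `X ++ Y` enumerate the same set as `X`. This yields the
  -- inclusion of `cl X` in `cl Y`.
  |∼-trans-⊆ : ∀ {Y X Z} → Y ⊆ˡ X → Y |∼ X → X |∼ Z → Y |∼ Z
  |∼-trans-⊆ {Y} {X} Y⊆X Y|∼X X|∼Z = |∼-cut Y|∼X (|∼-respˡ ∈-++⁺ˡ (++-⊆ X id Y⊆X) X|∼Z)

  -- Tokens, consistency and defaults

  data Token : Set ℓ where
    fact       : A → Token
    admit root : (X : List A) → Con X → Token

  fact-injective : Injective _≡_ _≡_ fact
  fact-injective refl = refl

  -- For `Y` in `Con`, the condition `Y |∼ X` expresses that `X` is contained in `cl Y`. Roots are
  -- compared as finite sets, so different enumerations of `Y` share them.
  E : List A → Pred Token ℓ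
  E Y (fact a)    = Y |∼ [ a ]
  E Y (admit X _) = Y ⊆ˡ X × Y |∼ X
  E Y (root X _)  = Y ⊆ˡ X × X ⊆ˡ Y

  Con* : Pred (List Token) ℓ
  Con* F = ∃ λ Y → Con Y × ⟪ F ⟫ ⊆ E Y

  data Rule : List Token → Token → Set ℓ where
    admitting  : ∀ {X} (X-con : Con X) → Rule (map fact X) (admit X X-con)
    rooting    : ∀ {X} (X-con : Con X) → Rule (map fact X) (root X X-con)
    concluding : ∀ {X a} (X-con : Con X) → X |∼ [ a ] → Rule [ admit X X-con ] (fact a)

  facts⊆E : ∀ {X Y} → Y |∼ X → ⟪ map fact X ⟫ ⊆ E Y
  facts⊆E {Y = Y} Y|∼X = map-⊆ (E Y) fact (|∼-element Y|∼X)

  facts⊆E⇒|∼ : ∀ {Y} X → Con Y → ⟪ map fact X ⟫ ⊆ E Y → Y |∼ X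
  facts⊆E⇒|∼ X Y-con X⊆E = |∼-pointwise X Y-con (X⊆E ∘ ∈-map⁺ fact)

  admit∈E : ∀ {X} (X-con : Con X) → E X (admit X X-con)
  admit∈E X-con = id , |∼-refl X-con

  root∈E : ∀ {X} (X-con : Con X) → E X (root X X-con)
  root∈E X-con = id , id

  Con*-facts : ∀ {X} → Con X → Con* (map fact X)
  Con*-facts X-con = _ , X-con , facts⊆E (|∼-refl X-con)

  -- A token built from `X` carries a proof of `Con X`, which makes `E X` available as a witness.
  Con*-token : ∀ b → Con* [ b ]
  Con*-token (fact a)        = Con*-facts (Con-singleton a)
  Con*-token (admit X X-con) = X , X-con , [-]-⊆ (E X) (admit∈E X-con)
  Con*-token (root X X-con)  = X , X-con , [-]-⊆ (E X) (root∈E X-con)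

  Rule⇒Con* : ∀ {V b} → Rule V b → Con* V
  Rule⇒Con* (admitting X-con)    = Con*-facts X-con
  Rule⇒Con* (rooting X-con)      = Con*-facts X-con
  Rule⇒Con* (concluding X-con _) = Con*-token _

  Con*-sub : ∀ {F G} → F ⊆ˡ G → Con* G → Con* F
  Con*-sub F⊆G (Y , Y-con , G⊆E) = Y , Y-con , λ b∈F → G⊆E (F⊆G b∈F)

  structure : ∃ Con → NormalDefaultStructure ℓ
  structure (_ , Y-con) = record
    { B              = Token
    ; Con*           = Con*
    -- Closing `Rule` under re-enumeration of the prerequisite makes `Δ` a relation on finite sets.
    ; Δ              = λ W b → ∃ λ V → Rule V b × V ⊆ˡ W × W ⊆ˡ V
    ; Con*-∅         = _ , Y-con , λ ()
    ; Con*-⊆         = Con*-sub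
    ; Con*-singleton = Con*-token
    ; Δ⇒Con*         = λ (_ , r , _ , W⊆V) → Con*-sub W⊆V (Rule⇒Con* r)
    ; Δ-resp         = λ W⊆W′ W′⊆W (V , r , V⊆W , W⊆V) →
                         V , r , (λ b∈ → W⊆W′ (V⊆W b∈)) , λ b∈ → W⊆V (W′⊆W b∈)
    }

  -- `E X` as an extension of `X`

  module _ (nonempty : ∃ Con) where
    open NormalDefaultStructure (structure nonempty) hiding (B; Con*)
    open DefaultProperties (structure nonempty)

    Rule⇒Δ : ∀ {V b} → Rule V b → Δ V b
    Rule⇒Δ r = _ , r , id , id

    E-consistent : ∀ {X b} → Con X → E X b → Consistent (｛ b ｝ ∪ E X)
    E-consistent X-con b∈E F F⊆ = _ , X-con , λ c∈F → [ (λ { refl → b∈E }) , id ]′ (F⊆ c∈F)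

    -- Any `E Y` witnessing consistency of `b` with `root X` contains `root X`, which forces `Y` and
    -- `X` to be the same finite set.
    E-with-root : ∀ {X b} (X-con : Con X) → Consistent (｛ b ｝ ∪ E X) →
                  ∃ λ Y → Y ⊆ˡ X × X ⊆ˡ Y × E Y b
    E-with-root {X} {b} X-con con
      with con (b ∷ [ root X X-con ])
               (∷-⊆ {P = ｛ b ｝ ∪ E X} (inj₁ refl) ([-]-⊆ (｛ b ｝ ∪ E X) (inj₂ (root∈E X-con))))
    ... | Y , _ , F⊆E with F⊆E (there (here refl))
    ... | Y⊆X , X⊆Y = Y , Y⊆X , X⊆Y , F⊆E (here refl)

    E-isExtension : ∀ {X} → Con X → IsExtension ⟪ map fact X ⟫ (E X)
    E-isExtension {X} X-con = Φ-least (facts⊆E (|∼-refl X-con)) closed , E⊆Φ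
      where
      fires : ∀ {V b} → Rule V b → ⟪ V ⟫ ⊆ Φ ⟪ map fact X ⟫ (E X) → E X b →
              Φ ⟪ map fact X ⟫ (E X) b
      fires r V⊆ b∈E = Φ-step (Rule⇒Δ r) V⊆ (E-consistent X-con b∈E)

      closed : ∀ {W b} → Δ W b → ⟪ W ⟫ ⊆ E X → Consistent (｛ b ｝ ∪ E X) → E X b
      closed (_ , admitting {Z} _ , V⊆W , _) W⊆E con with E-with-root X-con con
      ... | Y , _ , X⊆Y , Y⊆Z , _ =
        (λ a∈ → Y⊆Z (X⊆Y a∈)) , facts⊆E⇒|∼ Z X-con (λ b∈ → W⊆E (V⊆W b∈))
      closed (_ , rooting _ , _) W⊆E con with E-with-root X-con con
      ... | Y , Y⊆X , X⊆Y , Y⊆Z , Z⊆Y = (λ a∈ → Y⊆Z (X⊆Y a∈)) , λ a∈ → Y⊆X (Z⊆Y a∈)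
      closed (_ , concluding _ Z|∼a , V⊆W , _) W⊆E _ with W⊆E (V⊆W (here refl))
      ... | X⊆Z , X|∼Z = |∼-trans-⊆ X⊆Z X|∼Z Z|∼a

      -- `admit X` enters from the initial facts, and its concluding default then yields `fact a`.
      fact∈Φ : ∀ {a} → X |∼ [ a ] → Φ ⟪ map fact X ⟫ (E X) (fact a)
      fact∈Φ X|∼a =
        fires (concluding X-con X|∼a)
              ([-]-⊆ (Φ ⟪ map fact X ⟫ (E X)) (fires (admitting X-con) (zero ,_) (admit∈E X-con))) X|∼a

      E⊆Φ : E X ⊆ Φ ⟪ map fact X ⟫ (E X)
      E⊆Φ {fact _}        X|∼a            = fact∈Φ X|∼a
      E⊆Φ {admit _ Z-con} (X⊆Z , X|∼Z)    =
        fires (admitting Z-con) (map-⊆ (Φ _ _) fact λ a∈Z → fact∈Φ (|∼-element X|∼Z a∈Z)) (X⊆Z , X|∼Z)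
      E⊆Φ {root _ Z-con}  (X⊆Z , Z⊆X)     =
        fires (rooting Z-con) (map-⊆ (Φ _ _) fact λ a∈Z → zero , ∈-map⁺ fact (Z⊆X a∈Z)) (X⊆Z , Z⊆X)

    -- Arbitrary extensions of `X`

    module _ {X : List A} (X-con : Con X) {y : Pred Token ℓ}
             (ext : IsExtension ⟪ map fact X ⟫ y) where

      facts⊆y : ⟪ map fact X ⟫ ⊆ y
      facts⊆y b∈ = proj₁ ext (zero , b∈)

      fires : ∀ {V b} → Rule V b → ⟪ V ⟫ ⊆ y → Consistent (｛ b ｝ ∪ y) → y b
      fires r V⊆y con = proj₁ ext (Φ-step (Rule⇒Δ r) (λ b∈ → proj₂ ext (V⊆y b∈)) con)

      -- A guard keeps consistency witnesses below `X`: any finite part of `y`, taken together with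
      -- `g`, lies in some `E Y` with `Y ⊆ X`.
      Guarded : Set ℓ
      Guarded = ∃ λ g → Consistent (｛ g ｝ ∪ y) × (∀ {Y} → E Y g → Y ⊆ˡ X)

      -- The first default applied from X introduces admit Z or root Z for some Z ⊆ X.
      y⊆facts-or-guarded : ∀ {b} → y b → b ∈ map fact X ⊎ Guarded
      y⊆facts-or-guarded b∈y = Φ-least {P = λ b → b ∈ map fact X ⊎ Guarded} inj₁ closed (proj₂ ext b∈y)
        where
        prerequisite⊆X : ∀ {Z} → ⟪ map fact Z ⟫ ⊆ ⟪ map fact X ⟫ → Z ⊆ˡ X
        prerequisite⊆X Z⊆ a∈Z with ∈-map⁻ fact (Z⊆ (∈-map⁺ fact a∈Z))
        ... | _ , a∈X , refl = a∈X

        closed : ∀ {W b} → Δ W b → ⟪ W ⟫ ⊆ (λ c → c ∈ map fact X ⊎ Guarded) →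
                 Consistent (｛ b ｝ ∪ y) → b ∈ map fact X ⊎ Guarded
        closed (V , admitting _ , V⊆W , _) W⊆ con with ⊆-or V (λ b∈ → W⊆ (V⊆W b∈))
        -- An `E Y` containing `admit Z` has `Y ⊆ Z`, and the prerequisite facts give `Z ⊆ X`.
        ... | inj₁ V⊆X = inj₂ (_ , con , λ (Y⊆Z , _) a∈ → prerequisite⊆X V⊆X (Y⊆Z a∈))
        ... | inj₂ grd = inj₂ grd
        closed (V , rooting _ , V⊆W , _) W⊆ con with ⊆-or V (λ b∈ → W⊆ (V⊆W b∈))
        ... | inj₁ V⊆X = inj₂ (_ , con , λ (Y⊆Z , _) a∈ → prerequisite⊆X V⊆X (Y⊆Z a∈))
        ... | inj₂ grd = inj₂ grd
        closed (_ , concluding _ _ , V⊆W , _) W⊆ _ with W⊆ (V⊆W (here refl))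
        ... | inj₂ grd = inj₂ grd
        ... | inj₁ admit∈ with ∈-map⁻ fact admit∈
        ...   | _ , _ , ()

      -- If the finite part `G` of `y` consists of facts of `X`, then `E X` is the witness.
      -- Otherwise a guard is tested against `X` and `G` together: the resulting `E Y` has `Y ⊆ X`
      -- by the guard and `Y |∼ X` from the facts of `X`, so it contains `admit X`.
      admit-consistent : Consistent (｛ admit X X-con ｝ ∪ y)
      admit-consistent F F⊆ with ⊆-split F F⊆
      ... | G , G⊆y , F⊆G with ⊆-or G (λ b∈ → y⊆facts-or-guarded (G⊆y b∈))
      ...   | inj₁ G⊆X =
        X , X-con ,
        λ b∈ → ∷-⊆ {P = E X} (admit∈E X-con)
                   (λ c∈ → facts⊆E (|∼-refl X-con) (G⊆X c∈)) (F⊆G b∈)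
      ...   | inj₂ (g , con , below)
        with con (g ∷ map fact X ++ G)
                 (∷-⊆ {P = ｛ g ｝ ∪ y} (inj₁ refl)
                   (++-⊆ {P = ｛ g ｝ ∪ y} (map fact X) (λ b∈ → inj₂ (facts⊆y b∈)) (λ b∈ → inj₂ (G⊆y b∈))))
      ...   | Y , Y-con , H⊆E =
        Y , Y-con ,
        λ b∈ → ∷-⊆ {P = E Y} {x = admit X X-con}
                   (below (H⊆E (here refl)) , facts⊆E⇒|∼ X Y-con (λ c∈ → H⊆E (there (∈-++⁺ˡ c∈))))
                   (λ c∈ → H⊆E (there (∈-++⁺ʳ (map fact X) c∈))) (F⊆G b∈)

      admit∈y : y (admit X X-con)
      admit∈y = fires (admitting X-con) facts⊆y admit-consistent

      -- Testing `admit X` together with `G` gives an `E Y` with `Y ⊆ X` and `Y |∼ X`; cut then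
      -- transfers the conclusion `a` from `X` to `Y`.
      consequence-consistent : ∀ {a} → X |∼ [ a ] → Consistent (｛ fact a ｝ ∪ y)
      consequence-consistent X|∼a F F⊆ with ⊆-split F F⊆
      ... | G , G⊆y , F⊆G
        with admit-consistent (admit X X-con ∷ G)
                              (∷-⊆ {P = ｛ admit X X-con ｝ ∪ y} (inj₁ refl) (λ b∈ → inj₂ (G⊆y b∈)))
      ...   | Y , Y-con , H⊆E with H⊆E (here refl)
      ...     | Y⊆X , Y|∼X =
        Y , Y-con , λ b∈ → ∷-⊆ {P = E Y} (|∼-trans-⊆ Y⊆X Y|∼X X|∼a) (λ c∈ → H⊆E (there c∈)) (F⊆G b∈)

      consequence∈y : ∀ {a} → X |∼ [ a ] → y (fact a)
      consequence∈y X|∼a =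
        fires (concluding X-con X|∼a) ([-]-⊆ y admit∈y) (consequence-consistent X|∼a)

    -- Faithfulness of the embedding

    |∼⇔|∼ᴮ : ∀ X Y → Con X → (X |∼ Y) ⇔ (map fact X |∼ᴮ map fact Y)
    |∼⇔|∼ᴮ X Y X-con = mk⇔ to from
      where
      to : X |∼ Y → map fact X |∼ᴮ map fact Y
      to X|∼Y = Con*-facts X-con , λ y ext →
        map-⊆ y fact λ a∈Y → consequence∈y X-con ext (|∼-element X|∼Y a∈Y)

      from : map fact X |∼ᴮ map fact Y → X |∼ Y
      -- The single extension `E X` suffices, since its facts are exactly the consequences of `X`.
      from (_ , skeptical) = facts⊆E⇒|∼ Y X-con (skeptical (E X) (E-isExtension X-con))

  Con⇔Con* : ∀ (X : Pred Token ℓ) →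
    (∃ λ F → Con F × X ≐ ⟪ map fact F ⟫) ⇔ (X ⊆ (λ b → ∃ λ a → fact a ≡ b) × X ∈ᶠ Con*)
  Con⇔Con* X = mk⇔ to from
    where
    to : (∃ λ F → Con F × X ≐ ⟪ map fact F ⟫) → X ⊆ (λ b → ∃ λ a → fact a ≡ b) × X ∈ᶠ Con*
    to (F , F-con , X⊆F , F⊆X) =
      (λ b∈X → map-⊆ (λ b → ∃ λ a → fact a ≡ b) fact {F} (λ _ → _ , refl) (X⊆F b∈X)) ,
      map fact F , Con*-facts F-con , X⊆F , F⊆X

    from : X ⊆ (λ b → ∃ λ a → fact a ≡ b) × X ∈ᶠ Con* → ∃ λ F → Con F × X ≐ ⟪ map fact F ⟫
    from (X⊆A , G , (Y , Y-con , G⊆E) , X≐G) with ⊆-range fact G (λ b∈G → X⊆A (proj₂ X≐G b∈G))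
    -- Facts lying in a common `E Y` satisfy `Y |∼ F`, and the right side of `|∼` is always in
    -- `Con`.
    ... | F , refl = F , |∼⇒Conʳ (facts⊆E⇒|∼ F Y-con G⊆E) , X≐G

theorem5 : ∀ {ℓ : Level} (N : AbstractNonmonotonicSystem ℓ) →
    let open AbstractNonmonotonicSystem N in
    ∃ Con →
    Σ (NormalDefaultStructure ℓ) λ D →
    let open NormalDefaultStructure D in
    Σ (A → B) λ ι →
    Injective _≡_ _≡_ ι
    × (∀ (X : Pred B ℓ) →
    (∃ λ F → Con F × X ≐ ⟪ map ι F ⟫) ⇔ (X ⊆ (λ b → ∃ λ a → ι a ≡ b) × X ∈ᶠ Con*))
    × (∀ (X Y : List A) → Con X → Con Y → (X |∼ Y) ⇔ (map ι X |∼ᴮ map ι Y))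
theorem5 N nonempty =
  structure nonempty , fact , fact-injective , Con⇔Con* , λ X Y X-con _ → |∼⇔|∼ᴮ nonempty X Y X-con
  where open Representation N
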